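{- Let $a,b$ be positive integers and let $T_{a,b}=\{C_{i,1}:1\le i\le 2a+1\}\cup\{C_{a+1,j}:2\le j\le b+1\}$, a $T$-shaped polyomino of size $n=2a+b+1$. Then on the $n\times n$ board, $2\le \mathrm{cp}_{\mathrm{free}}(T_{a,b})\le 4$.
   Context: A cell $C_{i,j}$ ($i,j$ integers) is the closed unit square in column $i$ and row $j$ of the integer grid. A polyomino is a finite set of cells; its size is its number of cells. For a polyomino $\mathcal P$ of size $n$, the board is $\mathbb B=\{C_{i,j}:1\le i,j\le n\}$. A shift of $\mathcal P$ by an integer pair $(c,d)$ is $\{C_{x+c,y+d}:C_{x,y}\in\mathcal P\}$. Two polyominoes are free equivalent if one is obtained from the other by a rotation of the grid by an integer multiple of $90^\circ$ followed by a shift (reflections are not allowed). A set of polyominoes is a valid arrangement if all lie in $\mathbb B$ and they are pairwise disjoint. A free packing of $\mathcal P$ is a valid arrangement of polyominoes free equivalent to $\mathcal P$ such that adding any further polyomino free equivalent to $\mathcal P$ yields an invalid arrangement. The clumsy free packing number $\mathrm{cp}_{\mathrm{free}}(\mathcal P)$ is the minimum number of polyominoes in a free packing of $\mathcal P$ on the $n\times n$ board, $n=|\mathcal P|$. -}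

module Defs where

open import Data.Nat using (ℕ; zero; suc; _+_; _*_)
open import Data.Integer using (ℤ; +_; -_; _≤_) renaming (_+_ to _+ℤ_)
open import Data.Product using (_×_; _,_; ∃; Σ)
open import Data.List using (List; []; _∷_; map; upTo; _++_; length)
open import Data.List.Membership.Propositional using (_∈_)
open import Data.List.Relation.Unary.All using (All)
open import Data.List.Relation.Unary.AllPairs using (AllPairs)
open import Data.Empty using (⊥)
open import Relation.Nullary using (¬_)
open import Function using (_∘_; _⇔_)

-- A cell C_{i,j} is represented by its index pair (i , j).
Cell : Set
Cell = ℤ × ℤ

-- A polyomino: finite set of cells, represented by a list (read as a set
-- via membership).
Poly : Set
Poly = List Cell

-- rotation of the grid by 90° about the origin acting on cell indices
-- (any fixed centre is fine since a shift follows)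
rot90 : Cell → Cell
rot90 (x , y) = (- y , x)

rotN : ℕ → Cell → Cell
rotN zero    z = z
rotN (suc k) z = rot90 (rotN k z)

shiftCell : ℤ → ℤ → Cell → Cell
shiftCell c d (x , y) = (x +ℤ c , y +ℤ d)

placeAt : ℕ → ℤ → ℤ → Poly → Poly
placeAt k c d P = map (shiftCell c d ∘ rotN k) P

_≈ₛ_ : Poly → Poly → Set
Q ≈ₛ R = ∀ z → (z ∈ Q) ⇔ (z ∈ R)

-- Q is free equivalent to P: obtained from P by a rotation by a multiple
-- of 90° followed by a shift (no reflections)
FreeEquiv : Poly → Poly → Set
FreeEquiv Q P = Σ ℕ λ k → Σ ℤ λ c → Σ ℤ λ d → Q ≈ₛ placeAt k c d P

InBoardCell : ℕ → Cell → Set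
InBoardCell n (i , j) = ((+ 1 ≤ i) × (i ≤ + n)) × ((+ 1 ≤ j) × (j ≤ + n))

InBoard : ℕ → Poly → Set
InBoard n Q = All (InBoardCell n) Q

Disjoint : Poly → Poly → Set
Disjoint Q R = ∀ z → z ∈ Q → z ∈ R → ⊥

ValidArrangement : ℕ → List Poly → Set
ValidArrangement n As = All (InBoard n) As × AllPairs Disjoint As

FreePacking : ℕ → Poly → List Poly → Set
FreePacking n P As =
  All (λ Q → FreeEquiv Q P) As × ValidArrangement n As ×
  (∀ Q → FreeEquiv Q P → ¬ ValidArrangement n (Q ∷ As))

T : ℕ → ℕ → Poly
T a b = map (λ i → (+ suc i , + 1)) (upTo (2 * a + 1))
     ++ map (λ j → (+ (a + 1) , + (j + 2))) (upTo b)

{-# OPTIONS --safe #-}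
module Submission where

-- Let turn be the rotation of the n × n board onto itself by 90°, and consider the orbit under turn
-- of the upright T with bar in row min(a,b) and columns 1, …, 2a+1. Its four members are disjoint.
-- Since turn preserves the orbit, maximality only has to be checked against upright copies: for
-- a ≤ b their stems meet the stems of the orbit, for b ≤ a their bars meet the bars of the orbit,
-- apart from the copies in the lower left corner.
-- The same reduction to upright copies shows that every single copy leaves room for a second one.

open import Defs
open import Data.Nat using (ℕ; zero; suc; _+_; _*_; _≤_; _<_; z≤n; s≤s)
open import Data.Nat.Properties
  using (≤-trans; ≤-refl; ≤-reflexive; ≤-total; +-mono-≤; +-cancelʳ-≤; +-cancelʳ-≡; m≤m+n; m≤n+m;
         +-comm; +-identityʳ; n≮n; m≤n⇒∃[o]m+o≡n; <-≤-connex; m≤n⇒m<n∨m≡n; m≢1+n+m)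
open import Data.Nat.Tactic.RingSolver using (solve)
open import Data.Integer using (ℤ; +_; -[1+_]; -_; _-_) renaming (_+_ to _+ℤ_; _≤_ to _≤ℤ_)
import Data.Integer as ℤ
import Data.Integer.Properties as ℤ
import Data.Integer.Tactic.RingSolver as ℤ using (solve)
open import Algebra.Properties.AbelianGroup ℤ.+-0-abelianGroup
  using (xyx⁻¹≈y; //-rightDividesˡ; //-rightDividesʳ)
open import Data.Product using (_×_; _,_; ∃; ∃₂; proj₁; proj₂)
open import Data.Product.Properties using (,-injective)
open import Data.Sum using (_⊎_; inj₁; inj₂)
open import Data.Empty using (⊥; ⊥-elim)
open import Data.List using (List; []; _∷_; map; upTo; length)
open import Data.List.Properties using (map-∘; map-cong)
open import Data.List.Membership.Propositional using (_∈_)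
open import Data.List.Membership.Propositional.Properties
  using (∈-map⁺; ∈-map⁻; ∈-++⁺ˡ; ∈-++⁺ʳ; ∈-++⁻; ∈-upTo⁺; ∈-upTo⁻)
open import Data.List.Relation.Unary.All as All using (All)
import Data.List.Relation.Unary.All.Properties as All
open import Data.List.Relation.Unary.AllPairs as AllPairs using (AllPairs)
open import Data.List.Relation.Unary.Any using (Any; here; there)
open import Function using (_∘_; mk⇔; Equivalence)
open import Relation.Nullary using (¬_)
open import Relation.Binary.PropositionalEquality
  using (_≡_; refl; sym; trans; cong; cong₂; subst)

-- Linear arithmetic by certificates

-- Here `l ≤ r` is a sum of hypotheses joined by `_⊹_` and `k` is the slack left over, so that the
-- remaining equation is a semiring identity for `solve`. `≰-by` refutes inconsistent hypotheses in
-- the same way.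
≤-from-sum : ∀ {l r x y} → l ≤ r → ∀ k → y + l ≡ x + r + k → x ≤ y
≤-from-sum {l} {r} {x} {y} l≤r k eq = +-cancelʳ-≤ r x y
  (≤-trans (m≤m+n (x + r) k) (≤-trans (≤-reflexive (sym eq)) (+-mono-≤ (≤-refl {y}) l≤r)))

≡-from-sum : ∀ {l r x y} → l ≡ r → y + l ≡ x + r → x ≡ y
≡-from-sum {l} refl eq = +-cancelʳ-≡ l _ _ (sym eq)

≰-by : ∀ {l r} → l ≤ r → ∀ k → l ≡ suc (r + k) → ⊥
≰-by {l} {r} l≤r k eq =
  n≮n r (≤-trans (s≤s (m≤m+n r k)) (≤-trans (≤-reflexive (sym eq)) l≤r))

infixr 5 _⊹_
_⊹_ : ∀ {k l m n} → k ≤ l → m ≤ n → k + m ≤ l + n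
_⊹_ = +-mono-≤

i-[i-j]≡j : ∀ i j → i - (i - j) ≡ j
i-[i-j]≡j i j = ℤ.solve (i ∷ j ∷ [])

-j+k≡i-[j+[i-k]] : ∀ i j k → - j +ℤ k ≡ i - (j +ℤ (i - k))
-j+k≡i-[j+[i-k]] i j k = ℤ.solve (i ∷ j ∷ k ∷ [])

-- Rotations of the board

turn : ℕ → Cell → Cell
turn n (x , y) = (+ suc n - y , x)

turn⁴ : ∀ n z → turn n (turn n (turn n (turn n z))) ≡ z
turn⁴ n (x , y) = cong₂ _,_ (i-[i-j]≡j (+ suc n) x) (i-[i-j]≡j (+ suc n) y)

turn-injective : ∀ n {z w} → turn n z ≡ turn n w → z ≡ w
turn-injective n {z} {w} eq =
  trans (sym (turn⁴ n z)) (trans (cong (turn n ∘ turn n ∘ turn n) eq) (turn⁴ n w))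

-- The inverse of `turn n` is its cube, so three more turns lead back to `z`.
turn-closed⁻ : ∀ n (S : Cell → Set) → (∀ z → S z → S (turn n z)) → ∀ z → S (turn n z) → S z
turn-closed⁻ n S closed z s = subst S (turn⁴ n z) (closed _ (closed _ (closed _ s)))

reflect-range : ∀ n y → + 1 ≤ℤ y → y ≤ℤ + n → (+ 1 ≤ℤ + suc n - y) × (+ suc n - y ≤ℤ + n)
reflect-range n y 1≤y y≤n =
  subst (_≤ℤ + suc n - y) (//-rightDividesʳ (+ n) (+ 1))
    (ℤ.+-monoʳ-≤ (+ suc n) (ℤ.neg-mono-≤ y≤n)) ,
  ℤ.+-monoʳ-≤ (+ suc n) (ℤ.neg-mono-≤ 1≤y)

turn-InBoardCell : ∀ n z → InBoardCell n z → InBoardCell n (turn n z)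
turn-InBoardCell n (x , y) (bx , (1≤y , y≤n)) = reflect-range n y 1≤y y≤n , bx

turn-InBoard⁺ : ∀ n {Q} → InBoard n Q → InBoard n (map (turn n) Q)
turn-InBoard⁺ n = All.map⁺ ∘ All.map (turn-InBoardCell n _)

turn-InBoard⁻ : ∀ n {Q} → InBoard n (map (turn n) Q) → InBoard n Q
turn-InBoard⁻ n =
  All.map (turn-closed⁻ n (InBoardCell n) (turn-InBoardCell n) _) ∘ All.map⁻

Disjoint-sym : ∀ {Q R} → Disjoint Q R → Disjoint R Q
Disjoint-sym dis z z∈R z∈Q = dis z z∈Q z∈R

turn-Disjoint : ∀ n {Q R} → Disjoint Q R → Disjoint (map (turn n) Q) (map (turn n) R)
turn-Disjoint n {R = R} dis z z∈ z∈′ with ∈-map⁻ (turn n) z∈ | ∈-map⁻ (turn n) z∈′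
... | w , w∈Q , z≡ | w′ , w′∈R , z≡′ =
  dis w w∈Q (subst (_∈ R) (turn-injective n (trans (sym z≡′) z≡)) w′∈R)

-- Peels one rotation about the origin off a copy and replaces it by a turn of the board; this
-- drives the inductions on `k` that reduce all copies to upright ones.
placeAt-suc : ∀ n k c d P →
  placeAt (suc k) c d P ≡ map (turn n) (placeAt k d (+ suc n - c) P)
placeAt-suc n k c d P = trans (map-cong cell P) (map-∘ P)
  where
  cell : ∀ z → shiftCell c d (rotN (suc k) z) ≡ turn n (shiftCell d (+ suc n - c) (rotN k z))
  cell z = cong (_, _) (-j+k≡i-[j+[i-k]] (+ suc n) (proj₂ (rotN k z)) c)

turn-placeAt : ∀ n k c d P →
  map (turn n) (placeAt k c d P) ≡ placeAt (suc k) (+ suc n - d) c P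
turn-placeAt n k c d P =
  trans (cong (λ e → map (turn n) (placeAt k c e P)) (sym (i-[i-j]≡j (+ suc n) d)))
        (sym (placeAt-suc n k _ c P))

map-≈ₛ : ∀ f {Q R} → Q ≈ₛ R → map f Q ≈ₛ map f R
map-≈ₛ f Q≈R z = mk⇔ (image (Equivalence.to ∘ Q≈R)) (image (Equivalence.from ∘ Q≈R))
  where
  image : ∀ {S S′} → (∀ w → w ∈ S → w ∈ S′) → z ∈ map f S → z ∈ map f S′
  image S⊆S′ z∈ with ∈-map⁻ f z∈
  ... | w , w∈ , refl = ∈-map⁺ f (S⊆S′ w w∈)

placeAt-FreeEquiv : ∀ k c d P → FreeEquiv (placeAt k c d P) P
placeAt-FreeEquiv k c d P = k , c , d , λ z → mk⇔ (λ z∈ → z∈) (λ z∈ → z∈)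

turn-FreeEquiv : ∀ n {Q P} → FreeEquiv Q P → FreeEquiv (map (turn n) Q) P
turn-FreeEquiv n {Q} {P} (k , c , d , Q≈) =
  suc k , + suc n - d , c ,
  subst (map (turn n) Q ≈ₛ_) (turn-placeAt n k c d P) (map-≈ₛ (turn n) Q≈)

InBoard-resp : ∀ {n Q R} → Q ≈ₛ R → InBoard n Q → InBoard n R
InBoard-resp Q≈R inB = All.tabulate λ z∈R → All.lookup inB (Equivalence.from (Q≈R _) z∈R)

-- Fourfold symmetric arrangements

orbit : ℕ → Poly → List Poly
orbit n Q = Q ∷ map (turn n) Q ∷ map (turn n) (map (turn n) Q)
              ∷ map (turn n) (map (turn n) (map (turn n) Q)) ∷ []

Covered : List Poly → Cell → Set
Covered As z = Any (z ∈_) As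

turn-Covered : ∀ n Q z → Covered (orbit n Q) z → Covered (orbit n Q) (turn n z)
turn-Covered n Q z (here p) = there (here (∈-map⁺ (turn n) p))
turn-Covered n Q z (there (here p)) = there (there (here (∈-map⁺ (turn n) p)))
turn-Covered n Q z (there (there (here p))) = there (there (there (here (∈-map⁺ (turn n) p))))
turn-Covered n Q z (there (there (there (here p)))) with ∈-map⁻ (turn n) p
... | _ , p₂ , refl with ∈-map⁻ (turn n) p₂
... | _ , p₁ , refl with ∈-map⁻ (turn n) p₁
... | w , p₀ , refl = here (subst (_∈ Q) (sym (turn⁴ n w)) p₀)

-- Every pair is a turned image of a pair containing `Q`. A cell shared by `Q` and its third turn
-- becomes, after one more turn, a cell shared by `Q` and its first turn.
orbit-AllPairs : ∀ n Q → Disjoint Q (map (turn n) Q) →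
  Disjoint Q (map (turn n) (map (turn n) Q)) → AllPairs Disjoint (orbit n Q)
orbit-AllPairs n Q d₁ d₂ =
  (d₁ All.∷ d₂ All.∷ d₃ All.∷ All.[])
  AllPairs.∷ (turn-Disjoint n d₁ All.∷ turn-Disjoint n d₂ All.∷ All.[])
  AllPairs.∷ (turn-Disjoint n (turn-Disjoint n d₁) All.∷ All.[])
  AllPairs.∷ All.[] AllPairs.∷ AllPairs.[]
  where
  d₃ : Disjoint Q (map (turn n) (map (turn n) (map (turn n) Q)))
  d₃ z z∈Q p₃ with ∈-map⁻ (turn n) p₃
  ... | _ , p₂ , refl with ∈-map⁻ (turn n) p₂
  ... | _ , p₁ , refl with ∈-map⁻ (turn n) p₁
  ... | w , p₀ , refl =
    d₁ w p₀ (subst (_∈ map (turn n) Q) (turn⁴ n w) (∈-map⁺ (turn n) z∈Q))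

Meets : List Poly → Poly → Set
Meets As Q = ∃ λ z → z ∈ Q × Covered As z

-- The cells covered by the orbit are invariant under `turn n`, so a meeting cell found for the copy
-- turned back can be turned forward again.
orbit-Meets : ∀ n Q P →
  (∀ c d → InBoard n (placeAt 0 c d P) → Meets (orbit n Q) (placeAt 0 c d P)) →
  ∀ k c d → InBoard n (placeAt k c d P) → Meets (orbit n Q) (placeAt k c d P)
orbit-Meets n Q P base zero c d inB = base c d inB
orbit-Meets n Q P base (suc k) c d inB rewrite placeAt-suc n k c d P
  with orbit-Meets n Q P base k d (+ suc n - c) (turn-InBoard⁻ n inB)
... | z , z∈ , cov = turn n z , ∈-map⁺ (turn n) z∈ , turn-Covered n Q z cov

Covered⇒¬All-Disjoint : ∀ {As Q z} → z ∈ Q → Covered As z → ¬ All (Disjoint Q) As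
Covered⇒¬All-Disjoint z∈Q (here z∈A) (dis All.∷ _) = dis _ z∈Q z∈A
Covered⇒¬All-Disjoint z∈Q (there cov) (_ All.∷ diss) = Covered⇒¬All-Disjoint z∈Q cov diss

orbit-FreePacking : ∀ n P c d → let Q = placeAt 0 c d P in
  InBoard n Q → Disjoint Q (map (turn n) Q) → Disjoint Q (map (turn n) (map (turn n) Q)) →
  (∀ c d → InBoard n (placeAt 0 c d P) → Meets (orbit n Q) (placeAt 0 c d P)) →
  FreePacking n P (orbit n Q)
orbit-FreePacking n P c d inB d₁ d₂ base =
  (equiv All.∷ turn-FreeEquiv n equiv All.∷ turn-FreeEquiv n (turn-FreeEquiv n equiv)
     All.∷ turn-FreeEquiv n (turn-FreeEquiv n (turn-FreeEquiv n equiv)) All.∷ All.[]) ,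
  ((inB All.∷ turn-InBoard⁺ n inB All.∷ turn-InBoard⁺ n (turn-InBoard⁺ n inB)
     All.∷ turn-InBoard⁺ n (turn-InBoard⁺ n (turn-InBoard⁺ n inB)) All.∷ All.[]) ,
   orbit-AllPairs n Q d₁ d₂) ,
  maximal
  where
  Q = placeAt 0 c d P
  equiv = placeAt-FreeEquiv 0 c d P
  maximal : ∀ R → FreeEquiv R P → ¬ ValidArrangement n (R ∷ orbit n Q)
  maximal R (k , c′ , d′ , R≈) (inR All.∷ _ , diss AllPairs.∷ _)
    with orbit-Meets n Q P base k c′ d′ (InBoard-resp R≈ inR)
  ... | z , z∈ , cov = Covered⇒¬All-Disjoint (Equivalence.from (R≈ z) z∈) cov diss

-- Coordinates of turned cells

cell-≡ : ∀ {u u′ v v′} → u ≡ u′ → v ≡ v′ → _≡_ {A = Cell} (+ u , + v) (+ u′ , + v′)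
cell-≡ refl refl = refl

reflect-+ : ∀ {n v v′} → v + v′ ≡ suc n → + suc n - + v ≡ + v′
reflect-+ {n} {v} {v′} eq rewrite sym eq = xyx⁻¹≈y (+ v) (+ v′)

reflect-+⁻ : ∀ {n u v} → + u ≡ + suc n - + v → u + v ≡ suc n
reflect-+⁻ {n} {u} {v} eq =
  ℤ.+-injective (trans (cong (_+ℤ + v) eq) (//-rightDividesˡ (+ v) (+ suc n)))

module TurnCoordinates (n : ℕ) where

  turn-+ : ∀ {u v v′} → v + v′ ≡ suc n → turn n (+ u , + v) ≡ (+ v′ , + u)
  turn-+ eq = cong (_, _) (reflect-+ eq)

  turn²-+ : ∀ {u u′ v v′} → u + u′ ≡ suc n → v + v′ ≡ suc n →
    turn n (turn n (+ u , + v)) ≡ (+ u′ , + v′)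
  turn²-+ e e′ = cong₂ _,_ (reflect-+ e) (reflect-+ e′)

  turn³-+ : ∀ {u u′ v} → u + u′ ≡ suc n → turn n (turn n (turn n (+ u , + v))) ≡ (+ v , + u′)
  turn³-+ {v = v} e = cong₂ _,_ (i-[i-j]≡j (+ suc n) (+ v)) (reflect-+ e)

  -- Turnedᵏ u v u′ v′ expresses (u , v) = turnᵏ (u′ , v′) without subtraction.
  Turned Turned² Turned³ : ℕ → ℕ → ℕ → ℕ → Set
  Turned  u v u′ v′ = u + v′ ≡ suc n × v ≡ u′
  Turned² u v u′ v′ = u + u′ ≡ suc n × v + v′ ≡ suc n
  Turned³ u v u′ v′ = u ≡ v′ × v + u′ ≡ suc n

  Reflects : (ℕ → ℕ → ℕ → ℕ → Set) → (Cell → Cell) → Set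
  Reflects R f = ∀ u v u′ v′ → (+ u , + v) ≡ f (+ u′ , + v′) → R u v u′ v′

  turn-Turned : Reflects Turned (turn n)
  turn-Turned u v u′ v′ eq =
    reflect-+⁻ (proj₁ (,-injective eq)) , ℤ.+-injective (proj₂ (,-injective eq))

  turn²-Turned² : Reflects Turned² (turn n ∘ turn n)
  turn²-Turned² u v u′ v′ eq =
    reflect-+⁻ (proj₁ (,-injective eq)) , reflect-+⁻ (proj₂ (,-injective eq))

  turn³-Turned³ : Reflects Turned³ (turn n ∘ turn n ∘ turn n)
  turn³-Turned³ u v u′ v′ eq =
    ℤ.+-injective (trans (proj₁ (,-injective eq)) (i-[i-j]≡j (+ suc n) (+ v′))) ,
    reflect-+⁻ (proj₂ (,-injective eq))

-- Upright placements of T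

module Placements (a b : ℕ) where

  private n = 2 * a + b + 1

  -- Not abbreviated to n, which `solve` would treat as an atom.
  open TurnCoordinates (2 * a + b + 1)

  upright : ℕ → ℕ → Poly
  upright p q = placeAt 0 (+ p) (+ q) (T a b)

  -- The junction cell occurs twice: as bar a and as stem 0.
  data Upright (p q : ℕ) : ℕ → ℕ → Set where
    bar  : ∀ {i} → i ≤ 2 * a → Upright p q (suc i + p) (suc q)
    stem : ∀ {m} → m ≤ b → Upright p q (suc a + p) (suc m + q)

  bar∈T : ∀ {i} → i ≤ 2 * a → (+ suc i , + 1) ∈ T a b
  bar∈T {i} i≤2a = ∈-++⁺ˡ (∈-map⁺ (λ i → (+ suc i , + 1))
    (∈-upTo⁺ (subst (suc i ≤_) (+-comm 1 (2 * a)) (s≤s i≤2a))))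

  stem∈T : ∀ {m} → m ≤ b → (+ suc a , + suc m) ∈ T a b
  stem∈T {zero} _ = bar∈T (m≤m+n a _)
  stem∈T {suc j} j<b =
    subst (_∈ T a b) (cell-≡ (+-comm a 1) (+-comm j 2))
      (∈-++⁺ʳ _ (∈-map⁺ (λ j → (+ (a + 1) , + (j + 2))) (∈-upTo⁺ j<b)))

  T⁻ : ∀ {z} → z ∈ T a b → ∃₂ λ u v → z ≡ (+ u , + v) × Upright 0 0 u v
  T⁻ z∈ with ∈-++⁻ (map (λ i → (+ suc i , + 1)) (upTo (2 * a + 1))) z∈
  ... | inj₁ z∈bar with ∈-map⁻ _ z∈bar
  ...   | i , i∈ , refl = _ , _ , cell-≡ (sym (+-identityʳ (suc i))) refl ,
    bar (≤-from-sum (∈-upTo⁻ i∈) 0 (solve (a ∷ i ∷ [])))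
  T⁻ z∈ | inj₂ z∈stem with ∈-map⁻ _ z∈stem
  ...   | j , j∈ , refl = _ , _ ,
    cell-≡ {u = a + 1} {suc a + 0} {j + 2} {suc (suc j) + 0} (solve (a ∷ [])) (solve (j ∷ [])) ,
    stem (∈-upTo⁻ j∈)

  upright⁺ : ∀ {p q u v} → Upright p q u v → (+ u , + v) ∈ upright p q
  upright⁺ (bar i≤)  = ∈-map⁺ _ (bar∈T i≤)
  upright⁺ (stem m≤) = ∈-map⁺ _ (stem∈T m≤)

  upright⁻ : ∀ {p q z} → z ∈ upright p q → ∃₂ λ u v → z ≡ (+ u , + v) × Upright p q u v
  upright⁻ {p} {q} z∈ with ∈-map⁻ _ z∈
  ... | w , w∈T , refl with T⁻ w∈T
  ...   | _ , _ , refl , bar {i} i≤ =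
    _ , _ , cell-≡ (cong (_+ p) (+-identityʳ (suc i))) refl , bar i≤
  ...   | _ , _ , refl , stem {m} m≤ =
    _ , _ , cell-≡ (cong (_+ p) (+-identityʳ (suc a))) (cong (_+ q) (+-identityʳ (suc m))) ,
    stem m≤

  upright-InBoard : ∀ {p q} → p ≤ b → q ≤ 2 * a → InBoard n (upright p q)
  upright-InBoard {p} {q} p≤b q≤2a = All.tabulate inCell
    where
    inCell : ∀ {z} → z ∈ upright p q → InBoardCell n z
    inCell z∈ with upright⁻ z∈
    ... | _ , _ , refl , bar {i} i≤ =
      (ℤ.+≤+ (s≤s z≤n) , ℤ.+≤+ (≤-from-sum (i≤ ⊹ p≤b) 0 (solve (a ∷ b ∷ i ∷ p ∷ [])))) ,
      (ℤ.+≤+ (s≤s z≤n) , ℤ.+≤+ (≤-from-sum q≤2a b (solve (a ∷ b ∷ q ∷ []))))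
    ... | _ , _ , refl , stem {m} m≤ =
      (ℤ.+≤+ (s≤s z≤n) , ℤ.+≤+ (≤-from-sum p≤b a (solve (a ∷ b ∷ p ∷ [])))) ,
      (ℤ.+≤+ (s≤s z≤n) , ℤ.+≤+ (≤-from-sum (m≤ ⊹ q≤2a) 0 (solve (a ∷ b ∷ m ∷ q ∷ []))))

  data UprightShift : ℤ → ℤ → Set where
    shift : ∀ {p q} → p ≤ b → q ≤ 2 * a → UprightShift (+ p) (+ q)

  1≤1+⇒+ : ∀ c → + 1 ≤ℤ + 1 +ℤ c → ∃ λ p → c ≡ + p
  1≤1+⇒+ (+ p) _ = p , refl
  1≤1+⇒+ -[1+ zero ] (ℤ.+≤+ ())
  1≤1+⇒+ -[1+ suc _ ] ()

  upright-InBoard⁻ : ∀ c d → InBoard n (placeAt 0 c d (T a b)) → UprightShift c d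
  upright-InBoard⁻ c d inB = result
    where
    at : ∀ {z} → z ∈ T a b → InBoardCell n (shiftCell c d z)
    at z∈ = All.lookup inB (∈-map⁺ _ z∈)
    result : UprightShift c d
    -- The first bar cell makes both shifts nonnegative; the last bar cell and the tip of the stem
    -- bound them from above.
    result with 1≤1+⇒+ c (proj₁ (proj₁ (at (bar∈T z≤n))))
              | 1≤1+⇒+ d (proj₁ (proj₂ (at (bar∈T z≤n))))
              | at (bar∈T ≤-refl) | at (stem∈T ≤-refl)
    ... | p , refl | q , refl | (_ , ℤ.+≤+ right) , _ | _ , (_ , ℤ.+≤+ top) =
      shift (≤-from-sum right 0 (solve (a ∷ b ∷ p ∷ [])))
            (≤-from-sum top 0 (solve (a ∷ b ∷ q ∷ [])))

  Apart : (ℕ → ℕ → ℕ → ℕ → Set) → ℕ → ℕ → ℕ → ℕ → Set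
  Apart R p q p′ q′ = ∀ {u v u′ v′} → Upright p q u v → Upright p′ q′ u′ v′ →
    R u v u′ v′ → ⊥

  Apart⇒Disjoint : ∀ {R f} → Reflects R f → ∀ {p q p′ q′} → Apart R p q p′ q′ →
    Disjoint (upright p q) (map f (upright p′ q′))
  Apart⇒Disjoint {f = f} reflects apart z z∈ z∈′ with ∈-map⁻ f z∈′
  ... | w , w∈ , eq with upright⁻ z∈ | upright⁻ w∈
  ...   | _ , _ , refl , U | _ , _ , refl , U′ = apart U U′ (reflects _ _ _ _ eq)

  Apart⇒Disjoint₁ : ∀ {p q p′ q′} → Apart Turned p q p′ q′ →
    Disjoint (upright p q) (map (turn n) (upright p′ q′))
  Apart⇒Disjoint₁ = Apart⇒Disjoint turn-Turned

  Apart⇒Disjoint₂ : ∀ {p q p′ q′} → Apart Turned² p q p′ q′ →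
    Disjoint (upright p q) (map (turn n) (map (turn n) (upright p′ q′)))
  Apart⇒Disjoint₂ apart = subst (Disjoint _) (map-∘ _) (Apart⇒Disjoint turn²-Turned² apart)

  Apart⇒Disjoint₃ : ∀ {p q p′ q′} → Apart Turned³ p q p′ q′ →
    Disjoint (upright p q) (map (turn n) (map (turn n) (map (turn n) (upright p′ q′))))
  Apart⇒Disjoint₃ apart = subst (Disjoint _) (trans (map-∘ _) (cong (map (turn n)) (map-∘ _)))
    (Apart⇒Disjoint turn³-Turned³ apart)

  -- The orbit of an upright copy with bar in row s+1

  module Orbit {s : ℕ} (s<a : s < a) (s<b : s < b) where

    -- The turned bar fills column n-s, to the right of column 2a+1 since `s < b`. The turned stem
    -- lies in row a+1, above the bar, and starts in column 2a+1-s, to the right of the stem, both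
    -- since `s < a`.
    Apart-orbit₁ : Apart Turned 0 s 0 s
    Apart-orbit₁ (bar {i} i≤) (bar _) (e , _) =
      ≰-by (≤-reflexive (sym e) ⊹ i≤ ⊹ s<b) 0 (solve (a ∷ b ∷ s ∷ i ∷ []))
    Apart-orbit₁ (bar _) (stem _) (_ , e) =
      ≰-by (≤-reflexive (sym e) ⊹ s<a) 0 (solve (a ∷ s ∷ []))
    Apart-orbit₁ (stem _) (bar _) (e , _) =
      ≰-by (≤-reflexive (sym e) ⊹ s<b) a (solve (a ∷ b ∷ s ∷ []))
    Apart-orbit₁ (stem _) (stem {m} m≤) (e , _) =
      ≰-by (≤-reflexive (sym e) ⊹ m≤ ⊹ s<a) 0 (solve (a ∷ b ∷ s ∷ m ∷ []))

    -- The half-turned bar lies in row n-s, above the tip of the stem in row s+b+1; the half-turned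
    -- stem lies in column a+b+1 and descends only to row 2a+1-s.
    Apart-orbit₂ : Apart Turned² 0 s 0 s
    Apart-orbit₂ (bar _) (bar _) (_ , e) =
      ≰-by (≤-reflexive (sym e) ⊹ s<a ⊹ s<b) (suc a) (solve (a ∷ b ∷ s ∷ []))
    Apart-orbit₂ (bar _) (stem {m} m≤) (_ , e) =
      ≰-by (≤-reflexive (sym e) ⊹ m≤ ⊹ s<a ⊹ s<a) 1 (solve (a ∷ b ∷ s ∷ m ∷ []))
    Apart-orbit₂ (stem {m} m≤) (bar _) (_ , e) =
      ≰-by (≤-reflexive (sym e) ⊹ m≤ ⊹ s<a ⊹ s<a) 1 (solve (a ∷ b ∷ s ∷ m ∷ []))
    Apart-orbit₂ (stem _) (stem _) (e , _) =
      ≰-by (≤-reflexive (sym e) ⊹ s<b) s (solve (a ∷ b ∷ s ∷ []))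

    orbit-Covered : Cell → Set
    orbit-Covered = Covered (orbit n (upright 0 s))

    covered₀ : ∀ {u v} → Upright 0 s u v → orbit-Covered (+ u , + v)
    covered₀ U = here (upright⁺ U)

    covered₁ : ∀ {u v v′} → Upright 0 s u v → v + v′ ≡ suc (2 * a + b + 1) →
      orbit-Covered (+ v′ , + u)
    covered₁ U e = subst orbit-Covered (turn-+ e) (turn-Covered n _ _ (covered₀ U))

    covered₂ : ∀ {u u′ v v′} → orbit-Covered (+ u , + v) →
      u + u′ ≡ suc (2 * a + b + 1) → v + v′ ≡ suc (2 * a + b + 1) → orbit-Covered (+ u′ , + v′)
    covered₂ c e e′ =
      subst orbit-Covered (turn²-+ e e′) (turn-Covered n _ _ (turn-Covered n _ _ c))

    covered₃ : ∀ {u u′ v} → Upright 0 s u v → u + u′ ≡ suc (2 * a + b + 1) →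
      orbit-Covered (+ v , + u′)
    covered₃ U e = subst orbit-Covered (turn³-+ e)
      (turn-Covered n _ _ (turn-Covered n _ _ (turn-Covered n _ _ (covered₀ U))))

    OrbitMeets : ℕ → ℕ → Set
    OrbitMeets p q = Meets (orbit n (upright 0 s)) (upright p q)

    upright-orbit-FreePacking :
      (∀ {p q} → p ≤ b → q ≤ 2 * a → OrbitMeets p q) →
      FreePacking n (T a b) (orbit n (upright 0 s))
    upright-orbit-FreePacking meets = orbit-FreePacking n (T a b) (+ 0) (+ s)
      (upright-InBoard {q = s} z≤n (≤-from-sum s<a (suc a) (solve (a ∷ s ∷ []))))
      (Apart⇒Disjoint₁ Apart-orbit₁) (Apart⇒Disjoint₂ Apart-orbit₂) base
      where
      base : ∀ c d → InBoard n (placeAt 0 c d (T a b)) →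
        Meets (orbit n (upright 0 s)) (placeAt 0 c d (T a b))
      base c d inB with upright-InBoard⁻ c d inB
      ... | shift p≤b q≤2a = meets p≤b q≤2a

  -- Room for a second copy

  Avoidable : Poly → Set
  Avoidable Q = ∃ λ R → FreeEquiv R (T a b) × InBoard n R × Disjoint R Q

  turn-Avoidable : ∀ {Q} → Avoidable Q → Avoidable (map (turn n) Q)
  turn-Avoidable (R , equiv , inB , dis) =
    map (turn n) R , turn-FreeEquiv n equiv , turn-InBoard⁺ n inB , turn-Disjoint n dis

  placeAt-Avoidable :
    (∀ {p q} → p ≤ b → q ≤ 2 * a → Avoidable (upright p q)) →
    ∀ k c d → InBoard n (placeAt k c d (T a b)) → Avoidable (placeAt k c d (T a b))
  placeAt-Avoidable base zero c d inB with upright-InBoard⁻ c d inB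
  ... | shift p≤b q≤2a = base p≤b q≤2a
  placeAt-Avoidable base (suc k) c d inB rewrite placeAt-suc n k c d (T a b) =
    turn-Avoidable (placeAt-Avoidable base k d (+ suc n - c) (turn-InBoard⁻ n inB))

  upright-FreeEquiv : ∀ {p q} → FreeEquiv (upright p q) (T a b)
  upright-FreeEquiv {p} {q} = placeAt-FreeEquiv 0 (+ p) (+ q) (T a b)

  -- The half-turned copy occupies rows 2a+1 to n, above the bar in row q+1, and its own bar in row
  -- n is above the upright stem. The stems share a column exactly when `p + p′ ≡ b`.
  Apart-reversed : ∀ {p q p′} → q < 2 * a → (p + p′ ≡ b → ⊥) →
    Apart Turned² p q p′ 0
  Apart-reversed {p} {q} {p′} q<2a p+p′≢b (bar _) (bar _) (_ , e) =
    ≰-by (≤-reflexive (sym e) ⊹ q<2a) b (solve (a ∷ b ∷ q ∷ []))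
  Apart-reversed {p} {q} {p′} q<2a p+p′≢b (bar _) (stem {m} m≤) (_ , e) =
    ≰-by (≤-reflexive (sym e) ⊹ q<2a ⊹ m≤) 0 (solve (a ∷ b ∷ q ∷ m ∷ []))
  Apart-reversed {p} {q} {p′} q<2a p+p′≢b (stem {m} m≤) (bar _) (_ , e) =
    ≰-by (≤-reflexive (sym e) ⊹ q<2a ⊹ m≤) 0 (solve (a ∷ b ∷ q ∷ m ∷ []))
  Apart-reversed {p} {q} {p′} q<2a p+p′≢b (stem _) (stem _) (e , _) =
    p+p′≢b (≡-from-sum e (solve (a ∷ b ∷ p ∷ p′ ∷ [])))

  -- The sideways bar fills rows 1 to 2a+1 of column 1, which the shift `suc p` leaves free; its
  -- stem lies in row a+1, below row 2a+1.
  Apart-right : ∀ {p} → 1 ≤ a → Apart Turned³ (suc p) (2 * a) b 0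
  Apart-right {p} 1≤a (bar {i} _) (bar _) (e , _) =
    ≰-by (≤-reflexive e) (i + p) (solve (i ∷ p ∷ []))
  Apart-right 1≤a (bar _) (stem _) (_ , e) =
    ≰-by (≤-reflexive e ⊹ 1≤a) 0 (solve (a ∷ b ∷ []))
  Apart-right {p} 1≤a (stem _) (bar _) (e , _) =
    ≰-by (≤-reflexive e) (a + p) (solve (a ∷ p ∷ []))
  Apart-right 1≤a (stem {m} _) (stem _) (_ , e) =
    ≰-by (≤-reflexive e ⊹ 1≤a) m (solve (a ∷ b ∷ m ∷ []))

  Apart-left : 1 ≤ a → 1 ≤ b → Apart Turned 0 (2 * a) 0 0
  Apart-left 1≤a 1≤b (bar {i} i≤) (bar _) (e , _) =
    ≰-by (≤-reflexive (sym e) ⊹ i≤ ⊹ 1≤b) 0 (solve (a ∷ b ∷ i ∷ []))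
  Apart-left 1≤a 1≤b (bar _) (stem _) (_ , e) =
    ≰-by (≤-reflexive e ⊹ 1≤a) 0 (solve (a ∷ []))
  Apart-left 1≤a 1≤b (stem _) (bar _) (e , _) =
    ≰-by (≤-reflexive (sym e) ⊹ 1≤a ⊹ 1≤b) 1 (solve (a ∷ b ∷ []))
  Apart-left 1≤a 1≤b (stem {m} _) (stem _) (_ , e) =
    ≰-by (≤-reflexive e ⊹ 1≤a) m (solve (a ∷ m ∷ []))

  -- An upright copy not touching the top row leaves room for an upside-down copy hanging from the
  -- top row in another column; one touching it leaves the lowest 2a rows free, where a sideways
  -- copy fits with its bar in column 1 or n.
  upright-Avoidable : 1 ≤ a → 1 ≤ b → ∀ {p q} → p ≤ b → q ≤ 2 * a → Avoidable (upright p q)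
  upright-Avoidable 1≤a 1≤b {p} {q} p≤b q≤2a with m≤n⇒m<n∨m≡n q≤2a
  ... | inj₁ q<2a = reversed p refl
    where
    at : ∀ p′ → p′ ≤ b → (p + p′ ≡ b → ⊥) → Avoidable (upright p q)
    at p′ p′≤b p+p′≢b =
      _ , turn-FreeEquiv n (turn-FreeEquiv n upright-FreeEquiv) ,
      turn-InBoard⁺ n (turn-InBoard⁺ n (upright-InBoard p′≤b z≤n)) ,
      Disjoint-sym (Apart⇒Disjoint₂ (Apart-reversed q<2a p+p′≢b))
    reversed : ∀ p₁ → p ≡ p₁ → Avoidable (upright p q)
    -- One of the two extreme shifts always works: `p + 0` differs from `b` when `p` is zero, and
    -- `p + b` differs from `b` otherwise.
    reversed zero refl = at 0 z≤n λ { refl → n≮n 0 1≤b }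
    reversed (suc p₁) refl = at b ≤-refl λ e → m≢1+n+m b (sym e)
  upright-Avoidable 1≤a 1≤b {zero} _ _ | inj₂ refl =
    _ , turn-FreeEquiv n upright-FreeEquiv , turn-InBoard⁺ n (upright-InBoard z≤n z≤n) ,
    Disjoint-sym (Apart⇒Disjoint₁ (Apart-left 1≤a 1≤b))
  upright-Avoidable 1≤a 1≤b {suc p} _ _ | inj₂ refl =
    _ , turn-FreeEquiv n (turn-FreeEquiv n (turn-FreeEquiv n upright-FreeEquiv)) ,
    turn-InBoard⁺ n (turn-InBoard⁺ n (turn-InBoard⁺ n (upright-InBoard ≤-refl z≤n))) ,
    Disjoint-sym (Apart⇒Disjoint₃ (Apart-right 1≤a))

  packing-length : 1 ≤ a → 1 ≤ b → ∀ As → FreePacking n (T a b) As → 2 ≤ length As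
  packing-length 1≤a 1≤b [] (_ , _ , maximal) = ⊥-elim (maximal (upright 0 0) upright-FreeEquiv
    (upright-InBoard z≤n z≤n All.∷ All.[] , All.[] AllPairs.∷ AllPairs.[]))
  packing-length 1≤a 1≤b (Q ∷ []) ((k , c , d , Q≈) All.∷ _ , (inQ All.∷ _ , _) , maximal)
    with placeAt-Avoidable (upright-Avoidable 1≤a 1≤b) k c d (InBoard-resp Q≈ inQ)
  ... | R , equiv , inR , dis = ⊥-elim (maximal R equiv
    (inR All.∷ inQ All.∷ All.[] ,
     (disQ All.∷ All.[]) AllPairs.∷ All.[] AllPairs.∷ AllPairs.[]))
    where
    disQ : Disjoint R Q
    disQ z z∈R z∈Q = dis z z∈R (Equivalence.to (Q≈ z) z∈Q)
  packing-length _ _ (_ ∷ _ ∷ _) _ = s≤s (s≤s z≤n)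

-- If a ≤ b the four stems enclose the square [a+1, a+b+1]², and every upright stem in the board
-- crosses its boundary in row a+1 or row a+b+1.
module _ {s b : ℕ} (s<b : s < b) where

  open Placements (suc s) b
  open Orbit ≤-refl s<b

  enclosing-row : ∀ {p} → p ≤ b → orbit-Covered (+ (suc (suc s) + p) , + suc (suc s))
  -- With a = s+1, the turned stem in row a+1 starts only in column a+2; the corner in column a+1 is
  -- the second cell of the upright stem.
  enclosing-row {zero} _ = covered₀ (stem {m = 1} (≤-trans (s≤s z≤n) s<b))
  enclosing-row {suc p} p<b with m≤n⇒∃[o]m+o≡n p<b
  ... | m , refl = subst (λ u → orbit-Covered (+ (suc (suc s) + suc p) , + u))
    (+-identityʳ (suc (suc s)))
    (covered₁ {v′ = suc (suc s) + suc p} (stem {m = suc m} (s≤s (m≤n+m m p)))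
      (solve (s ∷ p ∷ m ∷ [])))

  enclosing-row′ : ∀ {p} → p ≤ b →
    orbit-Covered (+ (suc (suc s) + p) , + suc (suc s + b))
  -- The half-turn takes the bottom side of the square to its top side, exchanging `p` and b-p.
  enclosing-row′ {p} p≤b with m≤n⇒∃[o]m+o≡n p≤b
  ... | p′ , refl = covered₂ {u′ = suc (suc s) + p} {v′ = suc (suc s + b)}
    (enclosing-row (m≤n+m p′ p)) (solve (s ∷ p ∷ p′ ∷ [])) (solve (s ∷ p ∷ p′ ∷ []))

  stem-Meets : ∀ {p q} → p ≤ b → q ≤ 2 * suc s → OrbitMeets p q
  stem-Meets {p} {q} p≤b q≤2a with ≤-total q (suc s)
  -- From row q+1 the stem climbs a-q ≤ b steps to row a+1.
  ... | inj₁ q≤a with m≤n⇒∃[o]m+o≡n q≤a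
  ...   | m , q+m≡a = _ ,
    upright⁺ (stem {m = m} (≤-trans (≤-trans (m≤n+m m q) (≤-reflexive q+m≡a)) s<b)) ,
    subst (λ v → orbit-Covered (+ (suc (suc s) + p) , + suc v))
      (trans (sym q+m≡a) (+-comm q m)) (enclosing-row p≤b)
  stem-Meets {p} {q} p≤b q≤2a | inj₂ a≤q
    with m≤n⇒∃[o]m+o≡n {q} {suc s + b}
         (≤-from-sum (q≤2a ⊹ s<b) 0 (solve (s ∷ b ∷ q ∷ [])))
  -- Since `q` is at least a, row a+b+1 is at most `b` steps up.
  ...   | m , q+m≡a+b = _ ,
    upright⁺ (stem {m = m}
      (≤-from-sum (≤-reflexive q+m≡a+b ⊹ a≤q) 0 (solve (s ∷ b ∷ q ∷ m ∷ [])))) ,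
    subst (λ v → orbit-Covered (+ (suc (suc s) + p) , + suc v))
      (trans (sym q+m≡a+b) (+-comm q m)) (enclosing-row′ p≤b)

-- If b ≤ a every upright bar in the board contains the columns b+1, …, 2a+1. Unless it is leftmost
-- it also contains column 2a+2, whose lowest 2a+1 cells are covered. If it is leftmost, it crosses
-- the vertical bar in column b, or it lies in the lowest b rows and its copy meets the bar in row b.
module _ {s a : ℕ} (s<a : s < a) where

  open Placements a (suc s)
  open Orbit s<a ≤-refl

  bar-Meets : ∀ {p q} → p ≤ suc s → q ≤ 2 * a → OrbitMeets p q
  bar-Meets {suc p} {q} (s≤s p≤s) q≤2a
    with m≤n⇒∃[o]m+o≡n {p} {2 * a}
         (≤-from-sum (p≤s ⊹ s<a) (suc a) (solve (a ∷ s ∷ p ∷ [])))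
  -- Bar cell `i` is the one in column 2a+2, the column of the turned bar.
  ... | i , p+i≡2a = _ ,
    upright⁺ (bar {i = i} (≤-trans (m≤n+m i p) (≤-reflexive p+i≡2a))) ,
    subst (λ v → orbit-Covered (+ (suc i + suc p) , + v)) (+-identityʳ (suc q))
      (covered₁ {v′ = suc i + suc p} (bar q≤2a)
        (≡-from-sum p+i≡2a (solve (a ∷ s ∷ i ∷ p ∷ []))))
  bar-Meets {zero} {q} _ q≤2a with <-≤-connex q (suc s)
  ... | inj₁ (s≤s q≤s) with m≤n⇒∃[o]m+o≡n q≤s
  -- The stem cell in row b hits the middle of the orbit's upright bar.
  ...   | m , refl = _ ,
    upright⁺ (stem {m = m} (≤-trans (m≤n+m m q) (m≤n+m _ 1))) ,
    subst (λ v → orbit-Covered (+ (suc a + 0) , + suc v)) (+-comm q m)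
      (covered₀ (bar (m≤m+n a _)))
  bar-Meets {zero} {q} _ q≤2a | inj₂ b≤q
    with m≤n⇒∃[o]m+o≡n {q} {2 * a + suc s} (≤-trans q≤2a (m≤m+n _ (suc s)))
  ... | i , q+i≡2a+b = _ ,
    -- Bar cell `s` lies in column b, where the bar turned three times fills rows b+1 to n.
    upright⁺ (bar {i = s} (≤-from-sum s<a (suc a) (solve (a ∷ s ∷ [])))) ,
    subst (λ u → orbit-Covered (+ u , + suc q)) (sym (+-identityʳ (suc s)))
      (covered₃ {u′ = suc q}
        (bar {i = i} (≤-from-sum (≤-reflexive q+i≡2a+b ⊹ b≤q) 0 (solve (a ∷ s ∷ i ∷ q ∷ []))))
        (≡-from-sum q+i≡2a+b (solve (a ∷ s ∷ i ∷ q ∷ []))))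

theorem3p17 : (a b : ℕ) → 1 ≤ a → 1 ≤ b →
    (∀ (As : List Poly) → FreePacking (2 * a + b + 1) (T a b) As → 2 ≤ length As)
    × ∃ (λ (As : List Poly) → FreePacking (2 * a + b + 1) (T a b) As × length As ≤ 4)
theorem3p17 (suc a) (suc b) 1≤a 1≤b =
  packing-length 1≤a 1≤b , packing (≤-total a b)
  where
  open Placements (suc a) (suc b)
  packing : a ≤ b ⊎ b ≤ a → ∃ λ As →
    FreePacking (2 * suc a + suc b + 1) (T (suc a) (suc b)) As × length As ≤ 4
  -- In each case `≤-refl` forces the bar row s+1 to be the smaller parameter.
  packing (inj₁ a≤b) = _ ,
    Orbit.upright-orbit-FreePacking ≤-refl (s≤s a≤b) (stem-Meets (s≤s a≤b)) , ≤-refl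
  packing (inj₂ b≤a) = _ ,
    Orbit.upright-orbit-FreePacking (s≤s b≤a) ≤-refl (bar-Meets (s≤s b≤a)) , ≤-refl
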